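{- Let $G$ be a finite simple connected graph. Then $\chi(G)=\chi_g(G)$ if and only if $G\cong K_2$, where $\chi(G)$ is the chromatic number of $G$ and $\chi_g(G)$ is the graceful chromatic number of $G$.
   Context: For a positive integer $l$, write $[1,l]=\{1,2,\dots,l\}$. A graceful coloring of a simple graph $G$ with $l$ colors, where $l\ge 2$ is an integer, is a proper vertex coloring $g:V(G)\to[1,l]$ (adjacent vertices receive distinct values) such that the induced edge coloring $g^*:E(G)\to[1,l-1]$, $g^*(ab)=|g(a)-g(b)|$ for each edge $ab$, is a proper edge coloring (any two distinct edges sharing an endpoint receive distinct values). The graceful chromatic number $\chi_g(G)$ is the smallest integer $l\ge 2$ for which $G$ has a graceful coloring $g:V(G)\to[1,l]$. $K_2$ is the complete graph on two vertices. -}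

module Defs where

open import Data.Nat
open import Data.Nat.Properties
open import Data.Fin using (Fin; zero; suc; toℕ)
open import Data.Fin.Properties as Fin using (all?; toℕ<n; toℕ-injective)
open import Data.Product using (∃; _×_; _,_; proj₁; proj₂)
open import Data.Vec.Functional using (_∷_; head; tail)
open import Function using (_∘_)
open import Function.Bundles using (_↔_; _⇔_; Inverse)
open import Level using (0ℓ)
open import Relation.Binary using (Rel; Symmetric; Irreflexive; Decidable; tri<; tri≈; tri>)
open import Relation.Binary.Construct.Closure.ReflexiveTransitive using (Star)
open import Relation.Binary.PropositionalEquality
open import Relation.Nullary using (Dec; yes; no; ¬?; contradiction)
open import Relation.Nullary.Decidable using (map′; _×-dec_; _→-dec_)
import Relation.Unary as U

record SimpleGraph : Set₁ where
  field
    order  : ℕ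
    _~_    : Rel (Fin order) 0ℓ
    ~-sym  : Symmetric _~_
    ~-irr  : Irreflexive _≡_ _~_
    _~?_   : Decidable _~_

  V : Set
  V = Fin order

open SimpleGraph using (V)

-- As usual, the graph without vertices is not regarded as connected.
record Connected (G : SimpleGraph) : Set where
  open SimpleGraph G using (_~_)
  field
    vertex : V G
    path   : ∀ (a b : V G) → Star _~_ a b

record _≅_ (G H : SimpleGraph) : Set where
  private
    module G = SimpleGraph G
    module H = SimpleGraph H
  field
    bijection : V G ↔ V H
  open Inverse bijection using (to)
  field
    preserves : ∀ a b → (a G.~ b) ⇔ (to a H.~ to b)

K : ℕ → SimpleGraph
K n = record
  { order = n
  ; _~_   = _≢_
  ; ~-sym = λ a≢b → a≢b ∘ sym
  ; ~-irr = λ a≡b a≢b → a≢b a≡b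
  ; _~?_  = λ a b → ¬? (a Fin.≟ b)
  }

infix 4 _∈[1,_]
_∈[1,_] : ℕ → ℕ → Set
i ∈[1, l ] = 1 ≤ i × i ≤ l

record IsProperVertexColoring (G : SimpleGraph) (l : ℕ) (g : V G → ℕ) : Set where
  open SimpleGraph G using (_~_)
  field
    range  : ∀ a → g a ∈[1, l ]
    proper : ∀ a b → a ~ b → g a ≢ g b

-- An edge coloring is given by a function of ordered pairs of vertices of
-- which only the values on adjacent pairs matter; `symmetric` makes it a
-- function of the unordered edge.
record IsProperEdgeColoring (G : SimpleGraph) (l : ℕ) (h : V G → V G → ℕ) : Set where
  open SimpleGraph G using (_~_)
  field
    symmetric : ∀ a b → a ~ b → h a b ≡ h b a
    range     : ∀ a b → a ~ b → h a b ∈[1, l ]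
    proper    : ∀ a b c → a ~ b → a ~ c → b ≢ c → h a b ≢ h a c

induced : {A : Set} → (A → ℕ) → A → A → ℕ
induced g a b = ∣ g a - g b ∣

record IsGracefulColoring (G : SimpleGraph) (l : ℕ) (g : V G → ℕ) : Set where
  field
    vertexColoring : IsProperVertexColoring G l g
    edgeColoring   : IsProperEdgeColoring G (l ∸ 1) (induced g)

Colorable : SimpleGraph → ℕ → Set
Colorable G l = ∃ (IsProperVertexColoring G l)

GracefullyColorable : SimpleGraph → ℕ → Set
GracefullyColorable G l = 2 ≤ l × ∃ (IsGracefulColoring G l)

record IsLeast (P : ℕ → Set) (m : ℕ) : Set where
  field
    holds : P m
    least : ∀ l → P l → m ≤ l

-- The two chromatic numbers are obtained by searching for the least number
-- of colors; this requires deciding colorability and exhibiting a coloring.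

private
  least-from : ∀ {P : ℕ → Set} → U.Decidable P → ∀ d m → P (d + m) →
               (∀ l → P l → m ≤ l) → ∃ (IsLeast P)
  least-from P? zero m p lb = m , record { holds = p ; least = lb }
  least-from {P} P? (suc d) m p lb with P? m
  ... | yes pm = m , record { holds = pm ; least = lb }
  ... | no ¬pm = least-from P? d (suc m) (subst P (sym (+-suc d m)) p)
                   λ l pl → ≤∧≢⇒< (lb l pl) λ m≡l → ¬pm (subst P (sym m≡l) pl)

least-witness : ∀ {P : ℕ → Set} → U.Decidable P → ∃ P → ∃ (IsLeast P)
least-witness {P} P? (n , p) =
  least-from P? n 0 (subst P (sym (+-identityʳ n)) p) λ _ _ → z≤n

private
  Extensional : ∀ {n} → ((Fin n → ℕ) → Set) → Set
  Extensional P = ∀ {f g} → f ≗ g → P f → P g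

  ∷-cong : ∀ {n} x {f g : Fin n → ℕ} → f ≗ g → (x ∷ f) ≗ (x ∷ g)
  ∷-cong x f≗g zero    = refl
  ∷-cong x f≗g (suc i) = f≗g i

  ∷-η : ∀ {n} (f : Fin (suc n) → ℕ) → f ≗ (head f ∷ tail f)
  ∷-η f zero    = refl
  ∷-η f (suc i) = refl

  any-bounded? : ∀ n l {P : (Fin n → ℕ) → Set} → Extensional P → U.Decidable P →
                 (∀ g → P g → ∀ a → g a ≤ l) → Dec (∃ P)
  any-bounded? zero l ext P? bd =
    map′ (λ p → _ , p) (λ (_ , p) → ext (λ ()) p) (P? λ ())
  any-bounded? (suc n) l {P} ext P? bd = map′
    (λ (x , _ , f , p) → x ∷ f , p)
    (λ (g , p) → head g , s≤s (bd g p zero) , tail g , ext (∷-η g) p)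
    (anyUpTo? {P = λ x → ∃ λ f → P (x ∷ f)}
      (λ x → any-bounded? n l (λ eq → ext (∷-cong x eq)) (λ f → P? (x ∷ f))
               (λ f p a → bd (x ∷ f) p (suc a)))
      (suc l))

  ∈[1,]? : ∀ i l → Dec (i ∈[1, l ])
  ∈[1,]? i l = (1 ≤? i) ×-dec (i ≤? l)

module _ (G : SimpleGraph) where
  open SimpleGraph G using (_~_; ~-sym; ~-irr; _~?_; order)

  private
    vertex-ext : ∀ {l} → Extensional (IsProperVertexColoring G l)
    vertex-ext {l} eq c = record
      { range  = λ a → subst (_∈[1, l ]) (eq a) (range a)
      ; proper = λ a b a~b → subst₂ _≢_ (eq a) (eq b) (proper a b a~b)
      } where open IsProperVertexColoring c

    edge-ext : ∀ {l} → Extensional (IsProperEdgeColoring G l ∘ induced)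
    edge-ext {l} {f} {g} eq c = record
      { symmetric = λ a b a~b → subst₂ _≡_ (eq₂ a b) (eq₂ b a) (symmetric a b a~b)
      ; range     = λ a b a~b → subst (_∈[1, l ]) (eq₂ a b) (range a b a~b)
      ; proper    = λ a b c a~b a~c b≢c →
                      subst₂ _≢_ (eq₂ a b) (eq₂ a c) (proper a b c a~b a~c b≢c)
      } where
        open IsProperEdgeColoring c
        eq₂ : ∀ a b → induced f a b ≡ induced g a b
        eq₂ a b = cong₂ ∣_-_∣ (eq a) (eq b)

    vertex? : ∀ l → U.Decidable (IsProperVertexColoring G l)
    vertex? l g = map′
      (λ (r , p) → record { range = r ; proper = p })
      (λ c → let open IsProperVertexColoring c in range , proper)
      (all? (λ a → ∈[1,]? (g a) l) ×-dec
       all? (λ a → all? λ b → (a ~? b) →-dec ¬? (g a ≟ g b)))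

    edge? : ∀ l h → Dec (IsProperEdgeColoring G l h)
    edge? l h = map′
      (λ (s , r , p) → record { symmetric = s ; range = r ; proper = p })
      (λ c → let open IsProperEdgeColoring c in symmetric , range , proper)
      (all? (λ a → all? λ b → (a ~? b) →-dec (h a b ≟ h b a)) ×-dec
       all? (λ a → all? λ b → (a ~? b) →-dec ∈[1,]? (h a b) l) ×-dec
       all? (λ a → all? λ b → all? λ c → (a ~? b) →-dec ((a ~? c) →-dec
         (¬? (b Fin.≟ c) →-dec ¬? (h a b ≟ h a c)))))

  colorable? : U.Decidable (Colorable G)
  colorable? l = any-bounded? order l vertex-ext (vertex? l)
    λ _ c a → proj₂ (IsProperVertexColoring.range c a)

  gracefullyColorable? : U.Decidable (GracefullyColorable G)
  gracefullyColorable? l = (2 ≤? l) ×-dec any-bounded? order l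
    (λ eq c → let open IsGracefulColoring c in record
      { vertexColoring = vertex-ext eq vertexColoring
      ; edgeColoring   = edge-ext eq edgeColoring })
    (λ g → map′
      (λ (v , e) → record { vertexColoring = v ; edgeColoring = e })
      (λ c → let open IsGracefulColoring c in vertexColoring , edgeColoring)
      (vertex? l g ×-dec edge? (l ∸ 1) (induced g)))
    λ _ c a → proj₂ (IsProperVertexColoring.range (IsGracefulColoring.vertexColoring c) a)

  colorable : ∃ (Colorable G)
  colorable = order , suc ∘ toℕ , record
    { range  = λ a → s≤s z≤n , toℕ<n a
    ; proper = λ a b a~b eq → ~-irr (toℕ-injective (suc-injective eq)) a~b
    }

private
  pow : ℕ → ℕ
  pow i = 2 ^ i

  pow-mono-< : ∀ {i j} → i < j → pow i < pow j
  pow-mono-< = ^-monoʳ-< 2 (s≤s (s≤s z≤n))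

  pow-injective : ∀ {i j} → pow i ≡ pow j → i ≡ j
  pow-injective {i} {j} eq with <-cmp i j
  ... | tri< i<j _ _ = contradiction eq (<⇒≢ (pow-mono-< i<j))
  ... | tri≈ _ i≡j _ = i≡j
  ... | tri> _ _ j<i = contradiction (sym eq) (<⇒≢ (pow-mono-< j<i))

  pow-gap-below : ∀ {i j} → j < i → ∣ pow i - pow j ∣ < pow i
  pow-gap-below {i} {j} j<i = begin-strict
    ∣ pow i - pow j ∣ ≡⟨ ∣-∣-comm (pow i) (pow j) ⟩
    ∣ pow j - pow i ∣ ≡⟨ m≤n⇒∣m-n∣≡n∸m (<⇒≤ (pow-mono-< j<i)) ⟩
    pow i ∸ pow j     <⟨ ∸-monoʳ-< (m^n>0 2 j) (<⇒≤ (pow-mono-< j<i)) ⟩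
    pow i             ∎
    where open ≤-Reasoning

  pow-gap-above : ∀ {i j} → i < j → pow i ≤ ∣ pow i - pow j ∣
  pow-gap-above {i} {j} i<j = begin
    pow i                 ≡⟨ m+n∸n≡m (pow i) (pow i) ⟨
    pow i + pow i ∸ pow i ≡⟨ cong (λ x → pow i + x ∸ pow i) (+-identityʳ (pow i)) ⟨
    pow (suc i) ∸ pow i   ≤⟨ ∸-monoˡ-≤ (pow i) (^-monoʳ-≤ 2 i<j) ⟩
    pow j ∸ pow i         ≡⟨ m≤n⇒∣m-n∣≡n∸m (<⇒≤ (pow-mono-< i<j)) ⟨
    ∣ pow i - pow j ∣     ∎
    where open ≤-Reasoning

  pow-gap-injective : ∀ {i j k} → i ≢ j → i ≢ k →
                      ∣ pow i - pow j ∣ ≡ ∣ pow i - pow k ∣ → j ≡ k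
  pow-gap-injective {i} {j} {k} i≢j i≢k eq with <-cmp i j | <-cmp i k
  ... | tri≈ _ i≡j _ | _ = contradiction i≡j i≢j
  ... | _ | tri≈ _ i≡k _ = contradiction i≡k i≢k
  ... | tri< i<j _ _ | tri> _ _ k<i =
    contradiction (sym eq) (<⇒≢ (<-≤-trans (pow-gap-below k<i) (pow-gap-above i<j)))
  ... | tri> _ _ j<i | tri< i<k _ _ =
    contradiction eq (<⇒≢ (<-≤-trans (pow-gap-below j<i) (pow-gap-above i<k)))
  ... | tri< i<j _ _ | tri< i<k _ _ = pow-injective (∸-cancelʳ-≡
    (<⇒≤ (pow-mono-< i<j)) (<⇒≤ (pow-mono-< i<k))
    (trans (sym (m≤n⇒∣m-n∣≡n∸m (<⇒≤ (pow-mono-< i<j))))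
      (trans eq (m≤n⇒∣m-n∣≡n∸m (<⇒≤ (pow-mono-< i<k))))))
  ... | tri> _ _ j<i | tri> _ _ k<i = pow-injective (∸-cancelˡ-≡
    (<⇒≤ (pow-mono-< j<i)) (<⇒≤ (pow-mono-< k<i))
    (trans (sym (m≤n⇒∣n-m∣≡n∸m′ (<⇒≤ (pow-mono-< j<i))))
      (trans eq (m≤n⇒∣n-m∣≡n∸m′ (<⇒≤ (pow-mono-< k<i))))))
    where
      m≤n⇒∣n-m∣≡n∸m′ : ∀ {m n} → m ≤ n → ∣ n - m ∣ ≡ n ∸ m
      m≤n⇒∣n-m∣≡n∸m′ {m} {n} m≤n = trans (∣-∣-comm n m) (m≤n⇒∣m-n∣≡n∸m m≤n)

-- Assigning 2 ^ i to the i-th vertex is graceful on every graph.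
gracefullyColorable : ∀ G → ∃ (GracefullyColorable G)
gracefullyColorable G = 2 + pow order , s≤s (s≤s z≤n) , g , record
  { vertexColoring = record
      { range  = λ a → m^n>0 2 (toℕ a) , ≤-trans (g≤ a) (m≤n+m (pow order) 2)
      ; proper = λ a b a~b eq → ~⇒≢ a~b (pow-injective eq)
      }
  ; edgeColoring = record
      { symmetric = λ a b _ → ∣-∣-comm (g a) (g b)
      ; range     = λ a b a~b →
          n≢0⇒n>0 (λ eq → ~⇒≢ a~b (pow-injective (∣m-n∣≡0⇒m≡n eq))) ,
          ≤-trans (∣m-n∣≤m⊔n (g a) (g b))
            (≤-trans (⊔-lub (g≤ a) (g≤ b)) (n≤1+n (pow order)))
      ; proper    = λ a b c a~b a~c b≢c eq →
          b≢c (toℕ-injective (pow-gap-injective (~⇒≢ a~b) (~⇒≢ a~c) eq))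
      }
  }
  where
    open SimpleGraph G using (_~_; ~-irr; order)
    g : V G → ℕ
    g a = pow (toℕ a)
    g≤ : ∀ a → g a ≤ pow order
    g≤ a = <⇒≤ (pow-mono-< (toℕ<n a))
    ~⇒≢ : ∀ {a b} → a ~ b → toℕ a ≢ toℕ b
    ~⇒≢ a~b eq = ~-irr (toℕ-injective eq) a~b

chromaticNumber : ∀ G → ∃ (IsLeast (Colorable G))
chromaticNumber G = least-witness (colorable? G) (colorable G)

gracefulChromaticNumber : ∀ G → ∃ (IsLeast (GracefullyColorable G))
gracefulChromaticNumber G =
  least-witness (gracefullyColorable? G) (gracefullyColorable G)

χ : SimpleGraph → ℕ
χ G = proj₁ (chromaticNumber G)

χg : SimpleGraph → ℕ
χg G = proj₁ (gracefulChromaticNumber G)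

{-# OPTIONS --safe #-}

-- Let g be a graceful coloring with l ≥ 3 colors. A vertex of color 2 cannot
-- have neighbors of both colors 1 and 3, since both edges would get color 1;
-- hence it can be moved to one of these two colors. Then color 2 is free, and
-- renaming l to 2 leaves a proper coloring with l − 1 colors, so χ < χg. If
-- l = 2, all edges have color 1, so every vertex has at most one neighbor, and
-- a connected graph that has an edge is K₂.
module Submission where

open import Defs
open import Data.Fin using (Fin; zero; suc; toℕ)
open import Data.Fin.Properties as Fin using (any?; toℕ<n)
open import Data.Nat
open import Data.Nat.Properties
open import Data.Product using (∃; ∃₂; _×_; _,_; proj₁; proj₂)
open import Data.Sum using (_⊎_; inj₁; inj₂)
open import Function using (_∘_)
open import Function.Bundles using (_⇔_; mk⇔; mk↔ₛ′; Equivalence; Injection; Inverse)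
open import Function.Properties.Inverse using (↔⇒↣)
open import Relation.Binary.Construct.Closure.ReflexiveTransitive using (Star; ε; _◅_)
open import Relation.Binary.PropositionalEquality
open import Relation.Nullary using (Dec; yes; no; ¬_; contradiction)
open import Relation.Nullary.Decidable using (_×-dec_)

open SimpleGraph using (V)

-- Replacing the top color by a free one.

private
  rename : ℕ → ℕ → ℕ → ℕ
  rename k c x with x ≟ k
  ... | yes _ = c
  ... | no  _ = x

  -- The only collision that `rename` can create is between `k` and `c`, and neither argument is
  -- `c`.
  rename-injective : ∀ {k c x y} → x ≢ c → y ≢ c → rename k c x ≡ rename k c y → x ≡ y
  rename-injective {k} {c} {x} {y} x≢c y≢c eq with x ≟ k | y ≟ k
  ... | yes x≡k | yes y≡k = trans x≡k (sym y≡k)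
  ... | yes _   | no  _   = contradiction (sym eq) y≢c
  ... | no  _   | yes _   = contradiction eq x≢c
  ... | no  _   | no  _   = eq

  rename-range : ∀ {l c x} → c ∈[1, l ] → x ∈[1, suc l ] → rename (suc l) c x ∈[1, l ]
  rename-range {l} {c} {x} c∈ (1≤x , x≤) with x ≟ suc l
  ... | yes _   = c∈
  ... | no  x≢l = 1≤x , s≤s⁻¹ (≤∧≢⇒< x≤ x≢l)

module _ {G : SimpleGraph} where
  open SimpleGraph G using (_~_; _~?_; ~-sym; ~-irr)

  free-color⇒colorable : ∀ {l c g} → c ∈[1, l ] → (∀ a → g a ≢ c) →
                         IsProperVertexColoring G (suc l) g → Colorable G l
  free-color⇒colorable {l} {c} {g} c∈ g≢c col = rename (suc l) c ∘ g , record
    { range  = λ a → rename-range c∈ (range a)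
    ; proper = λ a b a~b → proper a b a~b ∘ rename-injective (g≢c a) (g≢c b)
    } where open IsProperVertexColoring col

  -- Recoloring the vertices of color 2.

  module _ {l g} (3≤l : 3 ≤ l) (graceful : IsGracefulColoring G l g) where
    open IsGracefulColoring graceful
    open IsProperVertexColoring vertexColoring
    private module E = IsProperEdgeColoring edgeColoring

    private
      HasNeighbor₁ : V G → Set
      HasNeighbor₁ a = ∃ λ b → a ~ b × g b ≡ 1

      hasNeighbor₁? : ∀ a → Dec (HasNeighbor₁ a)
      hasNeighbor₁? a = any? λ b → (a ~? b) ×-dec (g b ≟ 1)

      -- Unlike a definition of the new color by cases, this relation is
      -- convenient to analyse for two adjacent vertices at once.
      data Recolored (a : V G) : ℕ → Set where
        keep  : g a ≢ 2 → Recolored a (g a)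
        lower : g a ≡ 2 → ¬ HasNeighbor₁ a → Recolored a 1
        raise : g a ≡ 2 → HasNeighbor₁ a → Recolored a 3

      recolor : ∀ a → ∃ (Recolored a)
      recolor a with g a ≟ 2 | hasNeighbor₁? a
      ... | no  ≢2 | _      = _ , keep ≢2
      ... | yes ≡2 | no ¬nb = _ , lower ≡2 ¬nb
      ... | yes ≡2 | yes nb = _ , raise ≡2 nb

      recolored≢2 : ∀ {a x} → Recolored a x → x ≢ 2
      recolored≢2 (keep ≢2)   = ≢2
      recolored≢2 (lower _ _) = λ ()
      recolored≢2 (raise _ _) = λ ()

      recolored-range : ∀ {a x} → Recolored a x → x ∈[1, l ]
      recolored-range {a} (keep _) = range a
      recolored-range (lower _ _)  = s≤s z≤n , ≤-trans (s≤s z≤n) 3≤l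
      recolored-range (raise _ _)  = s≤s z≤n , 3≤l

      no-neighbors₁₃ : ∀ {a b} → g a ≡ 2 → HasNeighbor₁ a → a ~ b → g b ≢ 3
      no-neighbors₁₃ {a} {b} ga≡2 (c , a~c , gc≡1) a~b gb≡3 =
        E.proper a b c a~b a~c b≢c
          -- The two equations compose because `∣ 2 - 3 ∣` and `∣ 2 - 1 ∣` both compute to 1.
          (trans (cong₂ ∣_-_∣ ga≡2 gb≡3) (sym (cong₂ ∣_-_∣ ga≡2 gc≡1)))
        where
          b≢c : b ≢ c
          b≢c refl with trans (sym gb≡3) gc≡1
          ... | ()

      -- Comparing with the old color `g b` is enough: `both-2` shows that at most one end of an
      -- edge has color 2, so the other end keeps its color.
      moved-proper : ∀ {a b x} → a ~ b → g a ≡ 2 → Recolored a x → x ≢ g b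
      moved-proper a~b ≡2 (keep ≢2)    = contradiction ≡2 ≢2
      moved-proper a~b _ (lower _ ¬nb) = λ eq → ¬nb (_ , a~b , sym eq)
      moved-proper a~b _ (raise ≡2 nb) = no-neighbors₁₃ ≡2 nb a~b ∘ sym

      both-2 : ∀ {a b} → a ~ b → g a ≡ 2 → g b ≢ 2
      both-2 {a} {b} a~b ≡2 ≡2′ = proper a b a~b (trans ≡2 (sym ≡2′))

      recolored-proper : ∀ {a b x y} → a ~ b → Recolored a x → Recolored b y → x ≢ y
      recolored-proper {a} {b} a~b (keep _) (keep _) = proper a b a~b
      recolored-proper a~b (keep _) s@(lower ≡2 _) = moved-proper (~-sym a~b) ≡2 s ∘ sym
      recolored-proper a~b (keep _) s@(raise ≡2 _) = moved-proper (~-sym a~b) ≡2 s ∘ sym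
      recolored-proper a~b r@(lower ≡2 _) (keep _) = moved-proper a~b ≡2 r
      recolored-proper a~b r@(raise ≡2 _) (keep _) = moved-proper a~b ≡2 r
      recolored-proper a~b (lower ≡2 _) (lower ≡2′ _) = contradiction ≡2′ (both-2 a~b ≡2)
      recolored-proper a~b (lower ≡2 _) (raise ≡2′ _) = contradiction ≡2′ (both-2 a~b ≡2)
      recolored-proper a~b (raise ≡2 _) (lower ≡2′ _) = contradiction ≡2′ (both-2 a~b ≡2)
      recolored-proper a~b (raise ≡2 _) (raise ≡2′ _) = contradiction ≡2′ (both-2 a~b ≡2)

    recoloring-avoiding-2 : ∃ λ h → IsProperVertexColoring G l h × (∀ a → h a ≢ 2)
    recoloring-avoiding-2 = proj₁ ∘ recolor
      , record
          { range  = λ a → recolored-range (proj₂ (recolor a))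
          ; proper = λ a b a~b → recolored-proper a~b (proj₂ (recolor a)) (proj₂ (recolor b))
          }
      , λ a → recolored≢2 (proj₂ (recolor a))

  -- The bound `2 ≤ l` serves twice: it makes color 3 available among `suc l` colors, and it keeps
  -- the freed color 2 within `[1,l]`, where it replaces `suc l`.
  graceful⇒fewer-colors : ∀ {l} → 2 ≤ l → GracefullyColorable G (suc l) → Colorable G l
  graceful⇒fewer-colors 2≤l (_ , _ , graceful) =
    let _ , proper , avoids = recoloring-avoiding-2 (s≤s 2≤l) graceful
    in free-color⇒colorable (s≤s z≤n , 2≤l) avoids proper

  -- Comparison of the two chromatic numbers.

  graceful⇒colorable : ∀ {l} → GracefullyColorable G l → Colorable G l
  graceful⇒colorable (_ , g , graceful) = g , IsGracefulColoring.vertexColoring graceful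

  χ≤χg : χ G ≤ χg G
  χ≤χg = IsLeast.least (proj₂ (chromaticNumber G)) (χg G)
    (graceful⇒colorable (IsLeast.holds (proj₂ (gracefulChromaticNumber G))))

  edgeless⇒1-colorable : ¬ ∃₂ _~_ → Colorable G 1
  edgeless⇒1-colorable edgeless = (λ _ → 1) , record
    { range  = λ _ → s≤s z≤n , s≤s z≤n
    ; proper = λ a b a~b → contradiction (a , b , a~b) edgeless
    }

  edge⇒2≤colors : ∀ {a b l} → a ~ b → Colorable G l → 2 ≤ l
  edge⇒2≤colors {a} {b} {l} a~b (g , col) =
    ≰⇒> λ l≤1 → proper a b a~b (trans (g≡1 l≤1 a) (sym (g≡1 l≤1 b)))
    where
      open IsProperVertexColoring col
      g≡1 : l ≤ 1 → ∀ c → g c ≡ 1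
      g≡1 l≤1 c = ≤-antisym (≤-trans (proj₂ (range c)) l≤1) (proj₁ (range c))

  χ≡χg⇒χg≡2 : χ G ≡ χg G → χg G ≡ 2
  -- `χg G` is generalized to a variable `k` that can be matched on. The assumed equality becomes
  -- minimality of `k` among all proper colorings, which saving a color refutes once `k` is at least
  -- 3.
  χ≡χg⇒χg≡2 χ≡χg = decide (χg G) (IsLeast.holds (proj₂ (gracefulChromaticNumber G)))
    λ l colorable → subst (_≤ l) χ≡χg (IsLeast.least (proj₂ (chromaticNumber G)) l colorable)
    where
      decide : ∀ k → GracefullyColorable G k → (∀ l → Colorable G l → k ≤ l) → k ≡ 2
      decide 1 (s≤s () , _) _
      decide 2 _ _ = refl
      decide (suc k@(suc (suc _))) graceful minimal = contradiction
        (minimal k (graceful⇒fewer-colors (s≤s (s≤s z≤n)) graceful)) (n≮n k)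

  -- Connected graphs with unique neighbors.

  2-graceful⇒neighbor-unique : GracefullyColorable G 2 → ∀ {a b c} → a ~ b → a ~ c → b ≡ c
  2-graceful⇒neighbor-unique (_ , g , graceful) {a} {b} {c} a~b a~c with b Fin.≟ c
  ... | yes b≡c = b≡c
  ... | no  b≢c = contradiction (trans (label≡1 a~b) (sym (label≡1 a~c)))
                    (E.proper a b c a~b a~c b≢c)
    where
      module E = IsProperEdgeColoring (IsGracefulColoring.edgeColoring graceful)
      label≡1 : ∀ {a b} → a ~ b → induced g a b ≡ 1
      -- With two vertex colors, edge colors range over `[1,1]`.
      label≡1 {a} {b} a~b = let 1≤ , ≤1 = E.range a b a~b in ≤-antisym ≤1 1≤

  module _ (neighbor-unique : ∀ {a b c} → a ~ b → a ~ c → b ≡ c)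
           {p q : V G} (p~q : p ~ q) where

    private
      p≢q : p ≢ q
      p≢q p≡q = ~-irr p≡q p~q

      -- By uniqueness the only neighbor of `p` is `q` and conversely, so each step of a path swaps
      -- the two and never leaves the pair.
      reachable : ∀ {a b} → Star _~_ a b → a ≡ p ⊎ a ≡ q → b ≡ p ⊎ b ≡ q
      reachable ε           a∈          = a∈
      reachable (a~c ◅ c⋯b) (inj₁ refl) = reachable c⋯b (inj₂ (neighbor-unique a~c p~q))
      reachable (a~c ◅ c⋯b) (inj₂ refl) = reachable c⋯b (inj₁ (neighbor-unique a~c (~-sym p~q)))

    single-edge⇒K₂ : Connected G → G ≅ K 2
    single-edge⇒K₂ connected = record
      { bijection = mk↔ₛ′ to from to∘from from∘to
      ; preserves = λ a b → mk⇔ (adjacent⇒≢ a b) (≢⇒adjacent a b)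
      }
      where
        p-or-q : ∀ a → a ≡ p ⊎ a ≡ q
        p-or-q a = reachable (Connected.path connected p a) (inj₁ refl)

        to : V G → Fin 2
        to a with p-or-q a
        ... | inj₁ _ = zero
        ... | inj₂ _ = suc zero

        from : Fin 2 → V G
        from zero       = p
        from (suc zero) = q

        to∘from : ∀ i → to (from i) ≡ i
        -- `p-or-q` comes from an arbitrary path, so its answer at `p` is not known by computation
        -- and both cases must be treated.
        to∘from zero with p-or-q p
        ... | inj₁ _   = refl
        ... | inj₂ p≡q = contradiction p≡q p≢q
        to∘from (suc zero) with p-or-q q
        ... | inj₁ q≡p = contradiction (sym q≡p) p≢q
        ... | inj₂ _   = refl

        from∘to : ∀ a → from (to a) ≡ a
        from∘to a with p-or-q a
        ... | inj₁ a≡p = sym a≡p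
        ... | inj₂ a≡q = sym a≡q

        adjacent⇒≢ : ∀ a b → a ~ b → to a ≢ to b
        adjacent⇒≢ a b a~b eq =
          ~-irr (trans (sym (from∘to a)) (trans (cong from eq) (from∘to b))) a~b

        from-adjacent : ∀ i j → i ≢ j → from i ~ from j
        from-adjacent zero       zero       i≢j = contradiction refl i≢j
        from-adjacent zero       (suc zero) _   = p~q
        from-adjacent (suc zero) zero       _   = ~-sym p~q
        from-adjacent (suc zero) (suc zero) i≢j = contradiction refl i≢j

        ≢⇒adjacent : ∀ a b → to a ≢ to b → a ~ b
        ≢⇒adjacent a b ≢ = subst₂ _~_ (from∘to a) (from∘to b) (from-adjacent (to a) (to b) ≢)

  χ≡χg⇒K₂ : Connected G → χ G ≡ χg G → G ≅ K 2
  χ≡χg⇒K₂ connected χ≡χg with any? (λ a → any? (a ~?_))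
  ... | yes (_ , _ , p~q) =
    single-edge⇒K₂ (2-graceful⇒neighbor-unique 2-graceful) p~q connected
    where
      2-graceful : GracefullyColorable G 2
      2-graceful = subst (GracefullyColorable G) (χ≡χg⇒χg≡2 χ≡χg)
                     (IsLeast.holds (proj₂ (gracefulChromaticNumber G)))
  -- The one-vertex graph falls here. The convention that graceful colorings have at least 2 colors
  -- excludes it: one color suffices for a proper coloring, while `χ G` would have to be 2.
  ... | no edgeless = contradiction
    (subst (_≤ 1) (trans χ≡χg (χ≡χg⇒χg≡2 χ≡χg))
      (IsLeast.least (proj₂ (chromaticNumber G)) 1 (edgeless⇒1-colorable edgeless)))
    λ { (s≤s ()) }

-- The converse for the complete graph on two vertices.

private
  Fin₂-distance : ∀ {i j : Fin 2} → i ≢ j → ∣ toℕ i - toℕ j ∣ ≡ 1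
  Fin₂-distance {zero}     {zero}     i≢j = contradiction refl i≢j
  Fin₂-distance {zero}     {suc zero} _   = refl
  Fin₂-distance {suc zero} {zero}     _   = refl
  Fin₂-distance {suc zero} {suc zero} i≢j = contradiction refl i≢j

  Fin₂-other-unique : ∀ {i j k : Fin 2} → i ≢ j → i ≢ k → j ≡ k
  Fin₂-other-unique {_}        {zero}     {zero}     _   _   = refl
  Fin₂-other-unique {_}        {suc zero} {suc zero} _   _   = refl
  Fin₂-other-unique {zero}     {zero}     {suc zero} i≢j _   = contradiction refl i≢j
  Fin₂-other-unique {suc zero} {zero}     {suc zero} _   i≢k = contradiction refl i≢k
  Fin₂-other-unique {zero}     {suc zero} {zero}     _   i≢k = contradiction refl i≢k
  Fin₂-other-unique {suc zero} {suc zero} {zero}     i≢j _   = contradiction refl i≢j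

module _ {G : SimpleGraph} (G≅K₂ : G ≅ K 2) where
  open SimpleGraph G using (_~_)
  open _≅_ G≅K₂
  open Inverse bijection using (to; from; strictlyInverseˡ)

  private
    ≢-to : ∀ {a b} → a ~ b → to a ≢ to b
    ≢-to {a} {b} = Equivalence.to (preserves a b)

    label≡1 : ∀ {a b} → a ~ b → ∣ toℕ (to a) - toℕ (to b) ∣ ≡ 1
    label≡1 = Fin₂-distance ∘ ≢-to

  K₂⇒edge : from zero ~ from (suc zero)
  K₂⇒edge = Equivalence.from (preserves _ _)
    (subst₂ _≢_ (sym (strictlyInverseˡ zero)) (sym (strictlyInverseˡ (suc zero))) λ ())

  K₂⇒2-graceful : GracefullyColorable G 2
  -- The shift by `suc` gives the colors 1 and 2. It cancels by computation in differences, so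
  -- `label≡1` applies to the induced edge colors directly.
  K₂⇒2-graceful = s≤s (s≤s z≤n) , suc ∘ toℕ ∘ to , record
    { vertexColoring = record
        { range  = λ a → s≤s z≤n , toℕ<n (to a)
        ; proper = λ a b a~b → ≢-to a~b ∘ Fin.toℕ-injective ∘ suc-injective
        }
    ; edgeColoring = record
        { symmetric = λ a b _ → ∣-∣-comm (toℕ (to a)) (toℕ (to b))
        ; range     = λ a b a~b → ≤-reflexive (sym (label≡1 a~b)) , ≤-reflexive (label≡1 a~b)
        -- Two neighbors of `a` both map to the element of `Fin 2` other than `to a`, hence
        -- coincide, against `b≢c`.
        ; proper    = λ a b c a~b a~c b≢c _ →
            b≢c (Injection.injective (↔⇒↣ bijection) (Fin₂-other-unique (≢-to a~b) (≢-to a~c)))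
        }
    }

  K₂⇒χ≡χg : χ G ≡ χg G
  K₂⇒χ≡χg = ≤-antisym (χ≤χg {G}) (begin
    χg G ≤⟨ IsLeast.least (proj₂ (gracefulChromaticNumber G)) 2 K₂⇒2-graceful ⟩
    2    ≤⟨ edge⇒2≤colors {G} K₂⇒edge (IsLeast.holds (proj₂ (chromaticNumber G))) ⟩
    χ G  ∎)
    where open ≤-Reasoning

theorem3p1 : (G : SimpleGraph) → Connected G → (χ G ≡ χg G) ⇔ (G ≅ K 2)
theorem3p1 G connected = mk⇔ (χ≡χg⇒K₂ connected) K₂⇒χ≡χg
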